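{- The following lower bounds on query complexity hold. (1) For every integer $n\ge 1$, the query complexity of SFM on $n$ elements is at least $2n$. (2) For every integer $n\ge 2$, the query complexity of Non-Trivial Symmetric SFM on $n$ elements is at least $3n/2-2$. (3) For every integer $n\ge 2$, the query complexity of Non-Trivial SFM on $n$ elements is at least $\binom{n}{2}$.
   Context: Let $[n]=\{1,\dots,n\}$. A function $f:2^{[n]}\to\mathbb{R}$ is submodular if $f(X\cup Y)+f(X\cap Y)\le f(X)+f(Y)$ for all $X,Y\subseteq[n]$. It is symmetric if $f(S)=f([n]\setminus S)$ for all $S\subseteq[n]$. Submodular Function Minimization (SFM): given black-box access to a submodular function $f:2^{[n]}\to\mathbb{R}$ (a query consists of a set $S\subseteq[n]$ and returns $f(S)$; queries may be chosen adaptively), output an element of $\arg\min_{S\subseteq[n]} f(S)$ along with the value $\min_{S\subseteq[n]} f(S)$. Non-Trivial SFM: the same problem, with the minimum and the minimizer taken over $S\subseteq[n]$ with $S\notin\{\emptyset,[n]\}$. Non-Trivial Symmetric SFM: Non-Trivial SFM in which the input $f$ is additionally promised to be symmetric. The query complexity of each problem on $n$ elements is the minimum $q(n)$ such that some deterministic algorithm solves the problem correctly on all instances with $n$ elements using at most $q(n)$ queries. -}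

module Defs where

open import Data.Nat.Base as ℕ using (ℕ; suc)
import Data.Nat.Solver as ℕ-Solver
open import Data.Integer.Base as ℤ using (+_)
import Data.Integer.Properties as ℤ
open import Data.Rational.Base as ℚ using (ℚ; _/_)
import Data.Rational.Properties as ℚ
import Data.Rational.Solver as ℚ-Solver
open import Data.Rational.Unnormalised.Base as ℚᵘ using (mkℚᵘ; *≡*; *≤*)
import Data.Rational.Unnormalised.Properties as ℚᵘ
open import Data.Fin.Subset using (Subset; _∪_; _∩_; ∁; ⊥; ⊤)
open import Data.Product.Base using (Σ-syntax; _×_; _,_)
open import Data.Unit.Base using () renaming (⊤ to Unit)
open import Function.Bundles using (_⇔_; mk⇔)
open import Relation.Binary.PropositionalEquality

------------------------------------------------------------------------
-- Real numbers: Bishop's regular Cauchy sequences of rationals.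
-- Indices start at 0, so the n-th term is within 1/(n+1) of the limit.

recip : ℕ → ℚ
recip n = + 1 / suc n

record ℝ : Set where
  constructor mkℝ
  field
    seq     : ℕ → ℚ
    regular : ∀ m n → ℚ.∣ seq m ℚ.- seq n ∣ ℚ.≤ recip m ℚ.+ recip n

open ℝ public

infix 4 _≤ᴿ_ _≃ᴿ_

-- The slack 2/(n+1) is the sum of the errors of the two n-th terms.
_≤ᴿ_ : ℝ → ℝ → Set
x ≤ᴿ y = ∀ n → seq x n ℚ.≤ seq y n ℚ.+ (recip n ℚ.+ recip n)

_≃ᴿ_ : ℝ → ℝ → Set
x ≃ᴿ y = x ≤ᴿ y × y ≤ᴿ x

-- Position 2n+1 carries error 1/(2n+2), which is half of 1/(n+1).
double : ℕ → ℕ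
double n = suc (n ℕ.+ n)

recip-double : ∀ n → recip (double n) ℚ.+ recip (double n) ≡ recip n
recip-double n = ℚ.toℚᵘ-injective (begin
  ℚ.toℚᵘ (r ℚ.+ r)              ≈⟨ ℚ.toℚᵘ-homo-+ r r ⟩
  ℚ.toℚᵘ r ℚᵘ.+ ℚ.toℚᵘ r        ≈⟨ ℚᵘ.+-cong r≃ r≃ ⟩
  rᵘ ℚᵘ.+ rᵘ                    ≈⟨ *≡* (cong +_ (eq n)) ⟩
  mkℚᵘ (+ 1) n                  ≈⟨ ℚ.toℚᵘ-fromℚᵘ (mkℚᵘ (+ 1) n) ⟨
  ℚ.toℚᵘ (recip n)              ∎)
  where
  open ℚᵘ.≃-Reasoning
  r  = recip (double n)
  rᵘ = mkℚᵘ (+ 1) (double n)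
  r≃ : ℚ.toℚᵘ r ℚᵘ.≃ rᵘ
  r≃ = ℚ.toℚᵘ-fromℚᵘ rᵘ
  open ℕ-Solver.+-*-Solver
  eq : ∀ n → (1 ℕ.* suc (double n) ℕ.+ 1 ℕ.* suc (double n)) ℕ.* suc n
           ≡ 1 ℕ.* (suc (double n) ℕ.* suc (double n))
  eq = solve 1 (λ n → let d = con 2 :+ (n :+ n) in
         (con 1 :* d :+ con 1 :* d) :* (con 1 :+ n) := con 1 :* (d :* d)) refl

infixl 6 _+ᴿ_

_+ᴿ_ : ℝ → ℝ → ℝ
x +ᴿ y = mkℝ s reg
  where
  s : ℕ → ℚ
  s n = seq x (double n) ℚ.+ seq y (double n)

  reg : ∀ m n → ℚ.∣ s m ℚ.- s n ∣ ℚ.≤ recip m ℚ.+ recip n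
  reg m n = begin
    ℚ.∣ (a ℚ.+ b) ℚ.- (c ℚ.+ d) ∣              ≡⟨ cong ℚ.∣_∣ (regroup a b c d) ⟩
    ℚ.∣ (a ℚ.- c) ℚ.+ (b ℚ.- d) ∣              ≤⟨ ℚ.∣p+q∣≤∣p∣+∣q∣ (a ℚ.- c) (b ℚ.- d) ⟩
    ℚ.∣ a ℚ.- c ∣ ℚ.+ ℚ.∣ b ℚ.- d ∣            ≤⟨ ℚ.+-mono-≤ (regular x m′ n′) (regular y m′ n′) ⟩
    (recip m′ ℚ.+ recip n′) ℚ.+ (recip m′ ℚ.+ recip n′)
                                               ≡⟨ swap (recip m′) (recip n′) ⟩
    (recip m′ ℚ.+ recip m′) ℚ.+ (recip n′ ℚ.+ recip n′)
                                               ≡⟨ cong₂ ℚ._+_ (recip-double m) (recip-double n) ⟩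
    recip m ℚ.+ recip n                        ∎
    where
    open ℚ.≤-Reasoning
    m′ = double m
    n′ = double n
    a = seq x m′
    b = seq y m′
    c = seq x n′
    d = seq y n′
    open ℚ-Solver.+-*-Solver
    regroup : ∀ a b c d → (a ℚ.+ b) ℚ.- (c ℚ.+ d) ≡ (a ℚ.- c) ℚ.+ (b ℚ.- d)
    regroup = solve 4 (λ a b c d →
      (a :+ b) :- (c :+ d) := (a :- c) :+ (b :- d)) refl
    swap : ∀ p q → (p ℚ.+ q) ℚ.+ (p ℚ.+ q) ≡ (p ℚ.+ p) ℚ.+ (q ℚ.+ q)
    swap = solve 2 (λ p q → (p :+ q) :+ (p :+ q) := (p :+ p) :+ (q :+ q)) refl

------------------------------------------------------------------------
-- Set functions

SetFunction : ℕ → Set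
SetFunction n = Subset n → ℝ

Submodular : ∀ {n} → SetFunction n → Set
Submodular f = ∀ X Y → f (X ∪ Y) +ᴿ f (X ∩ Y) ≤ᴿ f X +ᴿ f Y

Symmetric : ∀ {n} → SetFunction n → Set
Symmetric f = ∀ S → f S ≃ᴿ f (∁ S)

Nontrivial : ∀ {n} → Subset n → Set
Nontrivial S = S ≢ ⊥ × S ≢ ⊤

------------------------------------------------------------------------
-- Deterministic adaptive query algorithms

-- An algorithm is a decision tree. The next step is an arbitrary function of
-- the real answer; it is not required to respect _≃ᴿ_, so lower bounds over
-- all trees cover in particular all those that do.
data Algorithm (n : ℕ) : Set where
  output : Subset n → ℝ → Algorithm n
  query  : Subset n → (ℝ → Algorithm n) → Algorithm n

result : ∀ {n} → Algorithm n → SetFunction n → Subset n × ℝ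
result (output S v) f = S , v
result (query S k)  f = result (k (f S)) f

queries : ∀ {n} → Algorithm n → SetFunction n → ℕ
queries (output S v) f = 0
queries (query S k)  f = suc (queries (k (f S)) f)

------------------------------------------------------------------------
-- Minimization problems and their query complexity

record Problem (n : ℕ) : Set₁ where
  field
    Instance : SetFunction n → Set
    Feasible : Subset n → Set

open Problem public

SFM : ∀ n → Problem n
SFM n .Instance   = Submodular
SFM n .Feasible _ = Unit

NontrivialSFM : ∀ n → Problem n
NontrivialSFM n .Instance = Submodular
NontrivialSFM n .Feasible = Nontrivial

NontrivialSymmetricSFM : ∀ n → Problem n
NontrivialSymmetricSFM n .Instance f = Submodular f × Symmetric f
NontrivialSymmetricSFM n .Feasible   = Nontrivial

IsMinimizer : ∀ {n} → Problem n → SetFunction n → Subset n → Set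
IsMinimizer P f S = Feasible P S × (∀ T → Feasible P T → f S ≤ᴿ f T)

IsSolution : ∀ {n} → Problem n → SetFunction n → Subset n × ℝ → Set
IsSolution P f (S , v) = IsMinimizer P f S × v ≃ᴿ f S

SolvableWithin : ∀ {n} → Problem n → ℕ → Set
SolvableWithin {n} P q =
  Σ[ A ∈ Algorithm n ] (∀ f → Instance P f →
    IsSolution P f (result A f) × queries A f ℕ.≤ q)

IsQueryComplexity : ∀ {n} → Problem n → ℕ → Set
IsQueryComplexity P q =
  SolvableWithin P q × (∀ q′ → SolvableWithin P q′ → q ℕ.≤ q′)

-- "The query complexity is at least b", phrased without presupposing that the
-- minimum has been computed; see queryComplexity≥⇔ for the equivalence.
QueryComplexity≥ : ∀ {n} → Problem n → ℚ → Set
QueryComplexity≥ P b = ∀ q → SolvableWithin P q → b ℚ.≤ + q / 1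

queryComplexity≥⇔ : ∀ {n} (P : Problem n) (b : ℚ) {q : ℕ} →
  IsQueryComplexity P q → QueryComplexity≥ P b ⇔ (b ℚ.≤ + q / 1)
queryComplexity≥⇔ P b {q} (solvable , least) = mk⇔
  (λ bound → bound q solvable)
  (λ b≤q q′ solvable′ → ℚ.≤-trans b≤q (/1-mono (least q′ solvable′)))
  where
  /1-mono : ∀ {m n} → m ℕ.≤ n → + m / 1 ℚ.≤ + n / 1
  /1-mono {m} {n} m≤n = ℚ.toℚᵘ-cancel-≤ (begin
    ℚ.toℚᵘ (+ m / 1)  ≃⟨ ℚ.toℚᵘ-fromℚᵘ (mkℚᵘ (+ m) 0) ⟩
    mkℚᵘ (+ m) 0      ≤⟨ *≤* (ℤ.*-monoʳ-≤-nonNeg (+ 1) (ℤ.+≤+ m≤n)) ⟩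
    mkℚᵘ (+ n) 0      ≃⟨ ℚ.toℚᵘ-fromℚᵘ (mkℚᵘ (+ n) 0) ⟨
    ℚ.toℚᵘ (+ n / 1)  ∎)
    where open ℚᵘ.≤-Reasoning

{-# OPTIONS --safe #-}
module Submission where

-- All three bounds come from a non-adaptive adversary: a fixed f with the
-- property that, for every set Q of too few queries, some other instance g agrees
-- with f on Q but is smaller than min f at a feasible set.
--
-- (1) f is defined by recursion on n. On the sets containing the first element it
-- is the function for n - 1; on the others it is a steep modular function whose
-- value at ∅ is one less than that of the recursive part. If Q has fewer than
-- 2(n - 1) sets of the first kind, recurse. Otherwise at most one set of the second
-- kind is queried: if that is not ∅, lower f at ∅; if it is ∅, replace the modular
-- part by a copy of the recursive part shifted down by one.
--
-- (2) The cut function of a complete graph with positive weights is strictly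
-- submodular on incomparable pairs, so any one minimum cut can be lowered on its
-- own. Splitting a root vertex in two, over and over, gives such a graph
-- in which 2n - 3 cuts are minimum.
--
-- (3) For n ≥ 3 take f(S) = (n - |S|) + (n - 1) min(|S|, 2), whose nontrivial
-- minimum is 2(n - 1). Any single 2-element X may be made to have rank 1 instead
-- of 2: this keeps f submodular and gives X a value below 2(n - 1).

open import Defs
open import Data.Nat.Base using (ℕ; _*_; _≥_)
open import Data.Nat.Combinatorics using (_C_)
open import Data.Integer.Base using (+_)
open import Data.Rational.Base using (_/_; _-_)
open import Data.Product.Base using (_×_)

open import Data.Bool.Base using (not)
open import Data.Bool.Properties using (not-involutive) renaming (_≟_ to _≟ᵇ_)
open import Data.Empty using (⊥-elim)
open import Data.Fin.Subset using (Subset; Side; inside; outside; _∪_; _∩_; ∁; ⊥; ⊤; ∣_∣)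
open import Data.Fin.Subset.Properties
  using (∪-comm; ∩-comm; ∪-idem; ∩-idem; ∣⊥∣≡0; ∣⊤∣≡n; ∣p∣≤n; ∣∁p∣≡n∸∣p∣)
import Data.Integer.Base as ℤ
import Data.Integer.Properties as ℤ
open import Data.List.Base using (List; []; _∷_; length; map)
open import Data.List.Membership.Propositional using (_∈_; _∉_)
open import Data.List.Membership.Propositional.Properties using (∈-map⁺)
import Data.List.Membership.DecPropositional as DecMembership
open import Data.List.Properties using (length-map)
open import Data.List.Relation.Unary.Any using (here; there)
open import Data.Nat.Base using (zero; suc; pred; _+_; _⊓_; _≤_; _<_; z≤n; s≤s)
open import Data.Nat.Combinatorics
  using (nCk+nC[k+1]≡[n+1]C[k+1]; nCk≡nC[n∸k]; nCn≡1; k>n⇒nCk≡0)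
import Data.Nat.Properties as ℕ
open import Data.Nat.Tactic.RingSolver using (solve-∀)
open import Data.Product.Base using (Σ-syntax; ∃-syntax; _,_; proj₁; proj₂)
open import Data.Rational.Base as ℚ using (0ℚ)
import Data.Rational.Properties as ℚ
open import Data.Rational.Unnormalised.Base as ℚᵘ using (mkℚᵘ; *≡*; *≤*)
import Data.Rational.Unnormalised.Properties as ℚᵘ
open import Data.Sum.Base using (_⊎_; inj₁; inj₂; [_,_]′)
open import Data.Vec.Base using ([]; _∷_)
open import Data.Vec.Properties using (≡-dec)
open import Function.Base using (_∘_)
open import Relation.Binary.Definitions using (DecidableEquality)
open import Relation.Binary.PropositionalEquality
open import Relation.Nullary using (Dec; ¬_; yes; no)
open import Relation.Nullary.Decidable using (from-no)

-- Natural numbers as reals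

/-mono-≤ : ∀ a b k l → a * suc l ≤ b * suc k → + a / suc k ℚ.≤ + b / suc l
/-mono-≤ a b k l al≤bk = ℚ.toℚᵘ-cancel-≤ (begin
  ℚ.toℚᵘ (+ a / suc k)  ≃⟨ ℚ.toℚᵘ-fromℚᵘ (mkℚᵘ (+ a) k) ⟩
  mkℚᵘ (+ a) k          ≤⟨ *≤* (subst₂ ℤ._≤_ (ℤ.pos-* a (suc l)) (ℤ.pos-* b (suc k)) (ℤ.+≤+ al≤bk)) ⟩
  mkℚᵘ (+ b) l          ≃⟨ ℚ.toℚᵘ-fromℚᵘ (mkℚᵘ (+ b) l) ⟨
  ℚ.toℚᵘ (+ b / suc l)  ∎)
  where open ℚᵘ.≤-Reasoning

/1-mono-≤ : ∀ a b → a ≤ b → + a / 1 ℚ.≤ + b / 1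
/1-mono-≤ a b a≤b = /-mono-≤ a b 0 0 (ℕ.*-monoˡ-≤ 1 a≤b)

/1-homo-+ : ∀ a b → + (a + b) / 1 ≡ + a / 1 ℚ.+ + b / 1
/1-homo-+ a b = ℚ.toℚᵘ-injective (begin
  ℚ.toℚᵘ (+ (a + b) / 1)                   ≈⟨ ℚ.toℚᵘ-fromℚᵘ (mkℚᵘ (+ (a + b)) 0) ⟩
  mkℚᵘ (+ (a + b)) 0                       ≈⟨ *≡* (cong (λ z → + z ℤ.* + 1)
                                                (sym (cong₂ _+_ (ℕ.*-identityʳ a) (ℕ.*-identityʳ b)))) ⟩
  mkℚᵘ (+ (a * 1 + b * 1)) 0               ≈⟨ *≡* (cong (ℤ._* + 1) (cong₂ ℤ._+_ (ℤ.pos-* a 1) (ℤ.pos-* b 1))) ⟩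
  mkℚᵘ (+ a) 0 ℚᵘ.+ mkℚᵘ (+ b) 0           ≈⟨ ℚᵘ.+-cong (ℚ.toℚᵘ-fromℚᵘ (mkℚᵘ (+ a) 0)) (ℚ.toℚᵘ-fromℚᵘ (mkℚᵘ (+ b) 0)) ⟨
  ℚ.toℚᵘ (+ a / 1) ℚᵘ.+ ℚ.toℚᵘ (+ b / 1)   ≈⟨ ℚ.toℚᵘ-homo-+ (+ a / 1) (+ b / 1) ⟨
  ℚ.toℚᵘ (+ a / 1 ℚ.+ + b / 1)             ∎)
  where open ℚᵘ.≃-Reasoning

p≤p+q : ∀ p q → 0ℚ ℚ.≤ q → p ℚ.≤ p ℚ.+ q
p≤p+q p q 0≤q = subst (ℚ._≤ p ℚ.+ q) (ℚ.+-identityʳ p) (ℚ.+-monoʳ-≤ p 0≤q)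

0≤recip+recip : ∀ m n → 0ℚ ℚ.≤ recip m ℚ.+ recip n
0≤recip+recip m n = ℚ.+-mono-≤ (0≤recip m) (0≤recip n)
  where
  0≤recip : ∀ n → 0ℚ ℚ.≤ recip n
  0≤recip n = ℚ.nonNegative⁻¹ (recip n) {{ℚ.normalize-nonNeg 1 (suc n)}}

ι : ℕ → ℝ
ι k = mkℝ (λ _ → + k / 1) λ m n →
  subst (ℚ._≤ recip m ℚ.+ recip n) (cong ℚ.∣_∣ (sym (ℚ.+-inverseʳ (+ k / 1)))) (0≤recip+recip m n)

ι-mono-≤ : ∀ a b → a ≤ b → ι a ≤ᴿ ι b
ι-mono-≤ a b a≤b n =
  ℚ.≤-trans (/1-mono-≤ a b a≤b) (p≤p+q (+ b / 1) (recip n ℚ.+ recip n) (0≤recip+recip n n))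

ι-mono-+ : ∀ a b c d → a + b ≤ c + d → ι a +ᴿ ι b ≤ᴿ ι c +ᴿ ι d
ι-mono-+ a b c d le n =
  subst₂ (λ p q → p ℚ.≤ q ℚ.+ (recip n ℚ.+ recip n)) (/1-homo-+ a b) (/1-homo-+ c d)
    (ι-mono-≤ (a + b) (c + d) le n)

+-cancelˡ-≤ : ∀ r p q → r ℚ.+ p ℚ.≤ r ℚ.+ q → p ℚ.≤ q
+-cancelˡ-≤ r p q le = subst₂ ℚ._≤_ (cancel p) (cancel q) (ℚ.+-monoʳ-≤ (ℚ.- r) le)
  where
  cancel : ∀ p → ℚ.- r ℚ.+ (r ℚ.+ p) ≡ p
  cancel p = trans (sym (ℚ.+-assoc (ℚ.- r) r p))
    (trans (cong (ℚ._+ p) (ℚ.+-inverseˡ r)) (ℚ.+-identityˡ p))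

-- If `a` exceeded `b`, it would do so by at least 1, which a slack below 1 cannot cover.
≤+slack⇒≤ : ∀ a b s → ¬ (+ 1 / 1 ℚ.≤ s) → + a / 1 ℚ.≤ + b / 1 ℚ.+ s → a ≤ b
≤+slack⇒≤ a b s s<1 le with a ℕ.≤? b
... | yes a≤b = a≤b
... | no  a≰b = ⊥-elim (s<1 (+-cancelˡ-≤ (+ b / 1) (+ 1 / 1) s (begin
  + b / 1 ℚ.+ + 1 / 1   ≡⟨ /1-homo-+ b 1 ⟨
  + (b + 1) / 1         ≤⟨ /1-mono-≤ (b + 1) a (subst (_≤ a) (ℕ.+-comm 1 b) (ℕ.≰⇒> a≰b)) ⟩
  + a / 1               ≤⟨ le ⟩
  + b / 1 ℚ.+ s         ∎)))
  where open ℚ.≤-Reasoning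

≤-via : ∀ p q r s → p ℚ.≤ q ℚ.+ s → q ℚ.≤ r ℚ.+ s → p ℚ.≤ r ℚ.+ (s ℚ.+ s)
≤-via p q r s p≤q+s q≤r+s = ℚ.≤-trans p≤q+s
  (subst (q ℚ.+ s ℚ.≤_) (ℚ.+-assoc r s s) (ℚ.+-monoˡ-≤ s q≤r+s))

-- The middle term is an arbitrary real, so that it can be the value that an algorithm outputs.
ι-reflects-≤ : ∀ a b v → ι a ≤ᴿ v → v ≤ᴿ ι b → a ≤ b
ι-reflects-≤ a b v a≤v v≤b = ≤+slack⇒≤ a b (s ℚ.+ s) (from-no (+ 1 / 1 ℚ.≤? s ℚ.+ s))
  (≤-via (+ a / 1) (seq v 4) (+ b / 1) s (a≤v 4) (v≤b 4))
  where
  -- The slack 4/5 of comparing the 4th terms twice is less than 1.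
  s = recip 4 ℚ.+ recip 4

-- Query traces and the adversary argument

trace : ∀ {n} → Algorithm n → SetFunction n → List (Subset n)
trace (output S v) f = []
trace (query S k)  f = S ∷ trace (k (f S)) f

length-trace : ∀ {n} (A : Algorithm n) f → length (trace A f) ≡ queries A f
length-trace (output S v) f = refl
length-trace (query S k)  f = cong suc (length-trace (k (f S)) f)

-- Algorithms may tell apart different representations of a real, so agreement is
-- required before applying ι: the answers are then literally the same sequences.
Agree : ∀ {n} → List (Subset n) → (f g : Subset n → ℕ) → Set
Agree Q f g = ∀ {S} → S ∈ Q → f S ≡ g S

result-agree : ∀ {n} (A : Algorithm n) f g →
  Agree (trace A (ι ∘ f)) g f → result A (ι ∘ f) ≡ result A (ι ∘ g)
result-agree (output S v) f g agree = refl
result-agree (query S k)  f g agree = trans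
  (result-agree (k (ι (f S))) f g (λ S∈ → agree (there S∈)))
  (cong (λ z → result (k (ι z)) (ι ∘ g)) (sym (agree (here refl))))

-- The adversary answers every query with f. An algorithm that stops too early
-- has not ruled out some g agreeing with f on all queries but with a smaller minimum.
Fooled : ∀ {n} → Problem n → (f : Subset n → ℕ) → ℕ → List (Subset n) → Set
Fooled P f m Q = ∃[ g ] Agree Q g f × Instance P (ι ∘ g) × ∃[ X ] Feasible P X × g X < m

-- An output `(S , v)` that is correct for both functions links them through `v`, even if `S` was
-- never queried: `f S` and `g S` both equal `v`, and `g S` is minimal for `g`.
solution-min : ∀ {n} (P : Problem n) f g s →
  IsSolution P (ι ∘ f) s → IsSolution P (ι ∘ g) s →
  ∀ X → Feasible P X → Σ[ S ∈ Subset n ] Feasible P S × f S ≤ g X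
solution-min P f g (S , v) ((S∈ , _) , (_ , fS≤v)) ((_ , minimal) , (v≤gS , _)) X X∈ =
  S , S∈ , ℕ.≤-trans (ι-reflects-≤ (f S) (g S) v fS≤v v≤gS)
    (ι-reflects-≤ (g S) (g X) (ι (g S)) (ι-mono-≤ (g S) (g S) ℕ.≤-refl) (minimal X X∈))

adversary-bound : ∀ {n} (P : Problem n) f m b →
  Instance P (ι ∘ f) → (∀ S → Feasible P S → m ≤ f S) →
  (∀ Q → length Q < b → Fooled P f m Q) →
  ∀ q → SolvableWithin P q → b ≤ q
adversary-bound P f m b fI f≥m fool q (A , correct) = ℕ.≮⇒≥ λ q<b →
  let #≤q = proj₂ (correct (ι ∘ f) fI)
      #<b = subst (_< b) (sym (length-trace A (ι ∘ f))) (ℕ.≤-<-trans #≤q q<b)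
      g , agree , gI , X , X∈ , gX<m = fool (trace A (ι ∘ f)) #<b
      S , S∈ , fS≤gX = solution-min P f g (result A (ι ∘ f)) (proj₁ (correct (ι ∘ f) fI))
        (subst (IsSolution P (ι ∘ g)) (sym (result-agree A f g agree)) (proj₁ (correct (ι ∘ g) gI))) X X∈
  in ℕ.<⇒≱ gX<m (ℕ.≤-trans (f≥m S S∈) fS≤gX)

-- Subsets and integer-valued set functions

_≟ˢ_ : ∀ {n} → DecidableEquality (Subset n)
_≟ˢ_ = ≡-dec _≟ᵇ_

open module DecMembershipˢ {n} = DecMembership (_≟ˢ_ {n}) using (_∈?_)

section : ∀ {n} → Side → List (Subset (suc n)) → List (Subset n)
section b       []                  = []
section inside  ((inside  ∷ S) ∷ Q) = S ∷ section inside Q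
section inside  ((outside ∷ S) ∷ Q) = section inside Q
section outside ((inside  ∷ S) ∷ Q) = section outside Q
section outside ((outside ∷ S) ∷ Q) = S ∷ section outside Q

∈-section : ∀ {n} b {S : Subset n} {Q} → (b ∷ S) ∈ Q → S ∈ section b Q
∈-section inside  (here refl) = here refl
∈-section outside (here refl) = here refl
∈-section inside  {Q = (inside  ∷ _) ∷ _} (there S∈) = there (∈-section inside S∈)
∈-section inside  {Q = (outside ∷ _) ∷ _} (there S∈) = ∈-section inside S∈
∈-section outside {Q = (inside  ∷ _) ∷ _} (there S∈) = ∈-section outside S∈
∈-section outside {Q = (outside ∷ _) ∷ _} (there S∈) = there (∈-section outside S∈)

length-section : ∀ {n} (Q : List (Subset (suc n))) →
  length (section inside Q) + length (section outside Q) ≡ length Q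
length-section []                  = refl
length-section ((inside  ∷ S) ∷ Q) = cong suc (length-section Q)
length-section ((outside ∷ S) ∷ Q) = trans (ℕ.+-suc _ _) (cong suc (length-section Q))

-- Pigeonhole: the two sections together have as many entries as `Q`.
section-< : ∀ {n} (Q : List (Subset (suc n))) {a b} → length Q < a + b →
  length (section inside Q) < a ⊎ length (section outside Q) < b
section-< Q {a} {b} lt with length (section inside Q) ℕ.<? a
... | yes in<a = inj₁ in<a
... | no  in≮a = inj₂ (ℕ.+-cancelˡ-< a _ _ (ℕ.≤-<-trans
  (ℕ.+-monoˡ-≤ (length (section outside Q)) (ℕ.≮⇒≥ in≮a))
  (subst (_< a + b) (sym (length-section Q)) lt)))

∈⇒length>0 : ∀ {A : Set} {x : A} {xs} → x ∈ xs → 0 < length xs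
∈⇒length>0 (here _)  = s≤s z≤n
∈⇒length>0 (there _) = s≤s z≤n

length<2⇒≡ : ∀ {A : Set} {x y : A} {xs} → length xs < 2 → x ∈ xs → y ∈ xs → x ≡ y
length<2⇒≡ _             (here refl) (here refl) = refl
length<2⇒≡ (s≤s (s≤s ())) (here _)   (there {xs = _ ∷ _} _)
length<2⇒≡ (s≤s (s≤s ())) (there {xs = _ ∷ _} _) _

∪-∩-comm : ∀ {n} (f : Subset n → ℕ) S T → f (S ∪ T) + f (S ∩ T) ≡ f (T ∪ S) + f (T ∩ S)
∪-∩-comm f S T = cong₂ (λ U V → f U + f V) (∪-comm S T) (∩-comm S T)

infix 4 _⊑_

-- Inclusion is stored as both equations, so that the union and the intersection of a comparable
-- pair can be rewritten directly.
_⊑_ : ∀ {n} → Subset n → Subset n → Set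
S ⊑ T = S ∪ T ≡ T × S ∩ T ≡ S

⊑-modular : ∀ {n} (f : Subset n → ℕ) {S T} → S ⊑ T → f (S ∪ T) + f (S ∩ T) ≡ f S + f T
⊑-modular f {S} {T} (∪≡ , ∩≡) = trans (cong₂ _+_ (cong f ∪≡) (cong f ∩≡)) (ℕ.+-comm (f T) (f S))

⊒-modular : ∀ {n} (f : Subset n → ℕ) {S T} → T ⊑ S → f (S ∪ T) + f (S ∩ T) ≡ f S + f T
⊒-modular f {S} {T} T⊑S = trans (∪-∩-comm f S T) (trans (⊑-modular f T⊑S) (ℕ.+-comm (f T) (f S)))

⊥-⊑ : ∀ {n} (T : Subset n) → ⊥ ⊑ T
⊥-⊑ []      = refl , refl
⊥-⊑ (y ∷ T) = let ∪≡ , ∩≡ = ⊥-⊑ T in cong (y ∷_) ∪≡ , cong (outside ∷_) ∩≡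

⊑-outside : ∀ {n} y {S T : Subset n} → S ⊑ T → (outside ∷ S) ⊑ (y ∷ T)
⊑-outside y (∪≡ , ∩≡) = cong (y ∷_) ∪≡ , cong (outside ∷_) ∩≡

⊑-inside : ∀ {n} {S T : Subset n} → S ⊑ T → (inside ∷ S) ⊑ (inside ∷ T)
⊑-inside (∪≡ , ∩≡) = cong (inside ∷_) ∪≡ , cong (inside ∷_) ∩≡

∣∣-modular : ∀ {n} (S T : Subset n) → ∣ S ∪ T ∣ + ∣ S ∩ T ∣ ≡ ∣ S ∣ + ∣ T ∣
∣∣-modular []            []            = refl
∣∣-modular (outside ∷ S) (outside ∷ T) = ∣∣-modular S T
∣∣-modular (outside ∷ S) (inside  ∷ T) = trans (cong suc (∣∣-modular S T)) (sym (ℕ.+-suc ∣ S ∣ ∣ T ∣))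
∣∣-modular (inside  ∷ S) (outside ∷ T) = cong suc (∣∣-modular S T)
∣∣-modular (inside  ∷ S) (inside  ∷ T) = cong suc (trans (ℕ.+-suc _ _)
  (trans (cong suc (∣∣-modular S T)) (sym (ℕ.+-suc ∣ S ∣ ∣ T ∣))))

⊑-or-∣∩∣< : ∀ {n} (S T : Subset n) → S ⊑ T ⊎ ∣ S ∩ T ∣ < ∣ S ∣
⊑-or-∣∩∣< []            []      = inj₁ (refl , refl)
⊑-or-∣∩∣< (outside ∷ S) (y ∷ T) with ⊑-or-∣∩∣< S T
... | inj₁ S⊑T = inj₁ (⊑-outside y S⊑T)
... | inj₂ lt  = inj₂ lt
⊑-or-∣∩∣< (inside ∷ S) (inside ∷ T) with ⊑-or-∣∩∣< S T
... | inj₁ S⊑T = inj₁ (⊑-inside S⊑T)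
... | inj₂ lt  = inj₂ (s≤s lt)
⊑-or-∣∩∣< (inside ∷ S) (outside ∷ T) with ⊑-or-∣∩∣< S T
... | inj₁ (_ , ∩≡) = inj₂ (s≤s (ℕ.≤-reflexive (cong ∣_∣ ∩≡)))
... | inj₂ lt       = inj₂ (ℕ.m<n⇒m<1+n lt)

-- Changing a set function at a single set

Submodularℕ : ∀ {n} → (Subset n → ℕ) → Set
Submodularℕ f = ∀ S T → f (S ∪ T) + f (S ∩ T) ≤ f S + f T

override : ∀ {n} → (Subset n → ℕ) → Subset n → ℕ → Subset n → ℕ
override f X k S with S ≟ˢ X
... | yes _ = k
... | no  _ = f S

override-same : ∀ {n} (f : Subset n → ℕ) X k → override f X k X ≡ k
override-same f X k with X ≟ˢ X
... | yes _   = refl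
... | no  X≢X = ⊥-elim (X≢X refl)

override-other : ∀ {n} (f : Subset n → ℕ) X k {S} → S ≢ X → override f X k S ≡ f S
override-other f X k {S} S≢X with S ≟ˢ X
... | yes S≡X = ⊥-elim (S≢X S≡X)
... | no  _   = refl

override-≤ : ∀ {n} (f : Subset n → ℕ) X k → k ≤ f X → ∀ S → override f X k S ≤ f S
override-≤ f X k k≤fX S with S ≟ˢ X
... | yes refl = k≤fX
... | no  _    = ℕ.≤-refl

override-agree : ∀ {n} (f : Subset n → ℕ) X k {Q} → X ∉ Q → Agree Q (override f X k) f
override-agree f X k X∉Q S∈Q = override-other f X k λ { refl → X∉Q S∈Q }

-- Lowering the value at `X` can only break inequalities with `X` on the right-hand side. Among
-- these, comparable pairs give equality for every function, and `slack` covers the others.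
override-submodular : ∀ {n} (f : Subset n → ℕ) X k → k ≤ f X → Submodularℕ f →
  (∀ T → X ⊑ T ⊎ T ⊑ X ⊎ f (X ∪ T) + f (X ∩ T) ≤ k + f T) →
  Submodularℕ (override f X k)
override-submodular {n} f X k k≤fX sub slack S T = by-cases (S ≟ˢ X) (T ≟ˢ X)
  where
  g = override f X k

  g≤f : ∀ S → g S ≤ f S
  g≤f = override-≤ f X k k≤fX

  at-X : ∀ T → T ≢ X → g (X ∪ T) + g (X ∩ T) ≤ g X + g T
  at-X T T≢X with slack T
  ... | inj₁ X⊑T        = ℕ.≤-reflexive (⊑-modular g X⊑T)
  ... | inj₂ (inj₁ T⊑X) = ℕ.≤-reflexive (⊒-modular g T⊑X)
  ... | inj₂ (inj₂ le)  = ℕ.≤-trans (ℕ.+-mono-≤ (g≤f (X ∪ T)) (g≤f (X ∩ T)))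
    (subst₂ (λ a b → _ ≤ a + b) (sym (override-same f X k)) (sym (override-other f X k T≢X)) le)

  by-cases : Dec (S ≡ X) → Dec (T ≡ X) → g (S ∪ T) + g (S ∩ T) ≤ g S + g T
  by-cases (yes refl) (yes refl) = ℕ.≤-reflexive (⊑-modular g (∪-idem X , ∩-idem X))
  by-cases (yes refl) (no T≢X)   = at-X T T≢X
  by-cases (no S≢X)   (yes refl) =
    subst₂ _≤_ (∪-∩-comm g X S) (ℕ.+-comm (g X) (g S)) (at-X S S≢X)
  by-cases (no S≢X)   (no T≢X)   = ℕ.≤-trans (ℕ.+-mono-≤ (g≤f (S ∪ T)) (g≤f (S ∩ T)))
    (subst₂ (λ a b → _ ≤ a + b) (sym (override-other f X k S≢X)) (sym (override-other f X k T≢X)) (sub S T))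

-- A function for SFM

-- The values at ∅ of hard (suc c) n and hard c (suc n) differ by exactly 1
-- for n ≥ 1. Since bound c n dominates hard c n and all its modifications in
-- hard-fooled, it is a slope steep enough for all of them.
bound : ℕ → ℕ → ℕ
bound c zero    = 1
bound c (suc n) = suc c + bound (suc c) n * suc n

glue : ∀ {n} → ℕ → ℕ → (Subset n → ℕ) → Subset (suc n) → ℕ
glue c M g (inside  ∷ S) = g S
glue c M g (outside ∷ S) = suc c + M * ∣ S ∣

hard : ℕ → ∀ n → Subset n → ℕ
hard c zero    S = 1
hard c (suc n)   = glue c (bound (suc c) n) (hard (suc c) n)

glue-≤ : ∀ {n} c M (g : Subset n → ℕ) → (∀ S → g S ≤ M) → ∀ S → glue c M g S ≤ suc c + M * suc n
glue-≤ {n} c M g g≤M (inside  ∷ S) = ℕ.≤-trans (g≤M S) (ℕ.≤-trans (ℕ.m≤m*n M (suc n)) (ℕ.m≤n+m _ (suc c)))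
glue-≤ {n} c M g g≤M (outside ∷ S) = ℕ.+-monoʳ-≤ (suc c) (ℕ.*-monoʳ-≤ M (ℕ.m≤n⇒m≤1+n (∣p∣≤n S)))

-- The critical pairs have the head in one set only. If the headless set `S` is not contained in
-- `T`, passing to `S ∩ T` lowers the modular branch by at least `M`, which pays for `g (S ∪ T)`.
glue-submodular : ∀ {n} c M (g : Subset n → ℕ) → (∀ S → g S ≤ M) →
  Submodularℕ g → Submodularℕ (glue c M g)
glue-submodular {n} c M g g≤M sub = go
  where
  factor : ∀ c M a b → suc c + M * a + (suc c + M * b) ≡ suc c + suc c + M * (a + b)
  factor = solve-∀

  ∪-∩-swap : ∀ S T → g (S ∪ T) + (suc c + M * ∣ S ∩ T ∣) ≡ g (T ∪ S) + (suc c + M * ∣ T ∩ S ∣)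
  ∪-∩-swap S T = cong₂ (λ U V → g U + (suc c + M * ∣ V ∣)) (∪-comm S T) (∩-comm S T)

  mixed : ∀ S T → g (S ∪ T) + (suc c + M * ∣ S ∩ T ∣) ≤ suc c + M * ∣ S ∣ + g T
  mixed S T with ⊑-or-∣∩∣< S T
  ... | inj₁ (∪≡ , ∩≡) = ℕ.≤-reflexive (trans
    (cong₂ (λ U V → g U + (suc c + M * ∣ V ∣)) ∪≡ ∩≡) (ℕ.+-comm (g T) _))
  ... | inj₂ lt = ℕ.≤-trans (begin
    g (S ∪ T) + (suc c + M * ∣ S ∩ T ∣)  ≤⟨ ℕ.+-monoˡ-≤ _ (g≤M (S ∪ T)) ⟩
    M + (suc c + M * ∣ S ∩ T ∣)          ≡⟨ shift c M ∣ S ∩ T ∣ ⟩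
    suc c + M * suc ∣ S ∩ T ∣            ≤⟨ ℕ.+-monoʳ-≤ (suc c) (ℕ.*-monoʳ-≤ M lt) ⟩
    suc c + M * ∣ S ∣                    ∎) (ℕ.m≤m+n _ (g T))
    where
    open ℕ.≤-Reasoning
    shift : ∀ c M a → M + (suc c + M * a) ≡ suc c + M * suc a
    shift = solve-∀

  go : Submodularℕ (glue c M g)
  go (inside  ∷ S) (inside  ∷ T) = sub S T
  go (outside ∷ S) (inside  ∷ T) = mixed S T
  go (inside  ∷ S) (outside ∷ T) = subst₂ _≤_ (∪-∩-swap T S) (ℕ.+-comm _ (g S)) (mixed T S)
  go (outside ∷ S) (outside ∷ T) = ℕ.≤-reflexive (begin
    suc c + M * ∣ S ∪ T ∣ + (suc c + M * ∣ S ∩ T ∣)  ≡⟨ factor c M ∣ S ∪ T ∣ ∣ S ∩ T ∣ ⟩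
    suc c + suc c + M * (∣ S ∪ T ∣ + ∣ S ∩ T ∣)      ≡⟨ cong (λ z → suc c + suc c + M * z) (∣∣-modular S T) ⟩
    suc c + suc c + M * (∣ S ∣ + ∣ T ∣)              ≡⟨ factor c M ∣ S ∣ ∣ T ∣ ⟨
    suc c + M * ∣ S ∣ + (suc c + M * ∣ T ∣)          ∎)
    where open ≡-Reasoning

twin : ∀ {n} → (Subset n → ℕ) → Subset (suc n) → ℕ
twin g (inside  ∷ S) = g S
twin g (outside ∷ S) = pred (g S)

twin-≤ : ∀ {n} (g : Subset n → ℕ) {M} → (∀ S → g S ≤ M) → ∀ S → twin g S ≤ M
twin-≤ g g≤M (inside  ∷ S) = g≤M S
twin-≤ g g≤M (outside ∷ S) = ℕ.≤-trans ℕ.pred[n]≤n (g≤M S)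

-- Subtracting 1 exactly when the head is absent subtracts a modular function. Positivity of `g`
-- makes `pred` a true subtraction.
twin-submodular : ∀ {n} (g : Subset n → ℕ) → (∀ S → 0 < g S) → Submodularℕ g → Submodularℕ (twin g)
twin-submodular g g>0 sub = go
  where
  outˡ : ∀ {a b c d} → 0 < c → 0 < b → a + b ≤ c + d → a + pred b ≤ pred c + d
  outˡ {a} {suc b} {suc c} {d} _ _ le = ℕ.≤-pred (subst (_≤ suc c + d) (ℕ.+-suc a b) le)
  outʳ : ∀ {a b c d} → 0 < d → 0 < b → a + b ≤ c + d → a + pred b ≤ c + pred d
  outʳ {a} {b} {c} {d} d>0 b>0 le =
    subst (a + pred b ≤_) (ℕ.+-comm (pred d) c) (outˡ d>0 b>0 (subst (a + b ≤_) (ℕ.+-comm c d) le))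
  out² : ∀ {a b c d} → 0 < c → 0 < d → 0 < a → 0 < b → a + b ≤ c + d → pred a + pred b ≤ pred c + pred d
  out² {suc a} {suc b} {suc c} {suc d} _ _ _ _ (s≤s le) = ℕ.≤-pred (subst₂ _≤_ (ℕ.+-suc a b) (ℕ.+-suc c d) le)

  go : Submodularℕ (twin g)
  go (inside  ∷ S) (inside  ∷ T) = sub S T
  go (outside ∷ S) (inside  ∷ T) = outˡ (g>0 S) (g>0 (S ∩ T)) (sub S T)
  go (inside  ∷ S) (outside ∷ T) = outʳ (g>0 T) (g>0 (S ∩ T)) (sub S T)
  go (outside ∷ S) (outside ∷ T) = out² (g>0 S) (g>0 T) (g>0 (S ∪ T)) (g>0 (S ∩ T)) (sub S T)

hard-≤ : ∀ c n S → hard c n S ≤ bound c n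
hard-≤ c zero    S = ℕ.≤-refl
hard-≤ c (suc n) S = glue-≤ c (bound (suc c) n) (hard (suc c) n) (hard-≤ (suc c) n) S

hard-submodular : ∀ c n → Submodularℕ (hard c n)
hard-submodular c zero    S T = ℕ.≤-refl
hard-submodular c (suc n) =
  glue-submodular c (bound (suc c) n) (hard (suc c) n) (hard-≤ (suc c) n) (hard-submodular (suc c) n)

hard>0 : ∀ c n S → 0 < hard c n S
hard>0 c zero    S             = s≤s z≤n
hard>0 c (suc n) (inside  ∷ S) = hard>0 (suc c) n S
hard>0 c (suc n) (outside ∷ S) = s≤s z≤n

hard-⊤ : ∀ c n → hard c n ⊤ ≡ 1
hard-⊤ c zero    = refl
hard-⊤ c (suc n) = hard-⊤ (suc c) n

hard-⊥ : ∀ c n → hard c (suc n) ⊥ ≡ suc c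
hard-⊥ c n rewrite ∣⊥∣≡0 n | ℕ.*-zeroʳ (bound (suc c) n) = ℕ.+-identityʳ (suc c)

singleton-⊑ : (S T : Subset 1) → S ⊑ T ⊎ T ⊑ S
singleton-⊑ (outside ∷ []) (_ ∷ [])       = inj₁ (refl , refl)
singleton-⊑ (inside  ∷ []) (outside ∷ []) = inj₂ (refl , refl)
singleton-⊑ (inside  ∷ []) (inside  ∷ []) = inj₁ (refl , refl)

2*suc : ∀ n → 2 * suc n ≡ 2 * n + 2
2*suc = solve-∀

-- The invariant `g S ≤ bound c n` allows the fooling function of the recursive call to be glued in
-- under the same slope.
hard-fooled : ∀ c n Q → length Q < 2 * n →
  ∃[ g ] Agree Q g (hard c n) × Submodularℕ g × (∀ S → g S ≤ bound c n) × ∃[ X ] g X ≡ 0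
hard-fooled c (suc n) Q lt with section-< Q {2 * n} {2} (subst (length Q <_) (2*suc n) lt)
... | inj₁ in<2n =
  let g , agree , sub , g≤M , X , gX≡0 = hard-fooled (suc c) n (section inside Q) in<2n
      M = bound (suc c) n
  in  glue c M g
    , (λ { {inside ∷ S} S∈ → agree (∈-section inside S∈) ; {outside ∷ S} S∈ → refl })
    , glue-submodular c M g g≤M sub
    , glue-≤ c M g g≤M
    , inside ∷ X , gX≡0
... | inj₂ out<2 with ⊥ ∈? section outside Q
-- The empty set is comparable with every set, so its value may be lowered freely.
...   | no ⊥∉ = override (hard c (suc n)) ⊥ 0
    , override-agree _ ⊥ 0 (⊥∉ ∘ ∈-section outside)
    , override-submodular _ ⊥ 0 z≤n (hard-submodular c (suc n)) (inj₁ ∘ ⊥-⊑)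
    , (λ S → ℕ.≤-trans (override-≤ _ ⊥ 0 z≤n S) (hard-≤ c (suc n) S))
    , ⊥ , override-same (hard c (suc n)) ⊥ 0
-- `twin` does not fit here, since `hard` on zero elements is 1 whatever the depth. But `⊥` uses up
-- the single query, so `⊤` is free, and all subsets of one element are comparable.
hard-fooled c (suc zero) Q lt | inj₂ out<2 | yes ⊥∈ = override (hard c 1) ⊤ 0
    , override-agree _ ⊤ 0 ⊤∉Q
    , override-submodular _ ⊤ 0 z≤n (hard-submodular c 1) (λ T → [ inj₁ , inj₂ ∘ inj₁ ]′ (singleton-⊑ ⊤ T))
    , (λ S → ℕ.≤-trans (override-≤ _ ⊤ 0 z≤n S) (hard-≤ c 1 S))
    , ⊤ , override-same (hard c 1) ⊤ 0
  where
  ⊤∉Q : ⊤ ∉ Q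
  ⊤∉Q ⊤∈ = ℕ.<⇒≱ lt (subst (2 ≤_) (length-section Q)
    (ℕ.+-mono-≤ (∈⇒length>0 (∈-section inside ⊤∈)) (∈⇒length>0 ⊥∈)))
-- The only headless set that can be queried is `⊥`, where both functions equal `suc c`. Without the
-- head, `⊤` drops from 1 to 0.
hard-fooled c (suc (suc n)) Q lt | inj₂ out<2 | yes ⊥∈ = twin g
    , agree
    , twin-submodular g (hard>0 (suc c) (suc n)) (hard-submodular (suc c) (suc n))
    , (λ S → ℕ.≤-trans (twin-≤ g (hard-≤ (suc c) (suc n)) S)
        (ℕ.≤-trans (ℕ.m≤m*n _ (suc (suc n))) (ℕ.m≤n+m _ (suc c))))
    , outside ∷ ⊤ , cong pred (hard-⊤ (suc c) (suc n))
  where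
  g = hard (suc c) (suc n)
  agree : Agree Q (twin g) (hard c (suc (suc n)))
  agree {inside  ∷ S} S∈ = refl
  agree {outside ∷ S} S∈ with length<2⇒≡ out<2 (∈-section outside S∈) ⊥∈
  ... | refl = trans (cong pred (hard-⊥ (suc c) n)) (sym (hard-⊥ c (suc n)))

-- A function for nontrivial SFM

nC0≡1 : ∀ n → n C 0 ≡ 1
nC0≡1 n = trans (nCk≡nC[n∸k] {k = 0} {n = n} z≤n) (nCn≡1 n)

-- Pascal's rule counts the sets of size `k` with and without the head, so one of the two sections
-- has too few queries.
unqueried-of-size : ∀ n k (Q : List (Subset n)) → length Q < n C k → ∃[ X ] ∣ X ∣ ≡ k × X ∉ Q
unqueried-of-size n zero [] lt = ⊥ , ∣⊥∣≡0 n , λ ()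
unqueried-of-size n zero (S ∷ Q) lt with subst (suc (length Q) <_) (nC0≡1 n) lt
... | s≤s ()
unqueried-of-size zero (suc k) Q lt with subst (length Q <_) (k>n⇒nCk≡0 {0} {suc k} (s≤s z≤n)) lt
... | ()
unqueried-of-size (suc n) (suc k) Q lt
  with section-< Q (subst (length Q <_) (sym (nCk+nC[k+1]≡[n+1]C[k+1] n k)) lt)
... | inj₁ in< =
  let X , ∣X∣≡k , X∉ = unqueried-of-size n k (section inside Q) in<
  in inside ∷ X , cong suc ∣X∣≡k , X∉ ∘ ∈-section inside
... | inj₂ out< =
  let X , ∣X∣≡k , X∉ = unqueried-of-size n (suc k) (section outside Q) out<
  in outside ∷ X , ∣X∣≡k , X∉ ∘ ∈-section outside

∣∁∣+∣∣ : ∀ {n} (S : Subset n) → ∣ ∁ S ∣ + ∣ S ∣ ≡ n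
∣∁∣+∣∣ S = trans (cong (_+ ∣ S ∣) (∣∁p∣≡n∸∣p∣ S)) (ℕ.m∸n+n≡m (∣p∣≤n S))

∣∁∣-modular : ∀ {n} (S T : Subset n) → ∣ ∁ (S ∪ T) ∣ + ∣ ∁ (S ∩ T) ∣ ≡ ∣ ∁ S ∣ + ∣ ∁ T ∣
∣∁∣-modular {n} S T = ℕ.+-cancelʳ-≡ (∣ S ∣ + ∣ T ∣) _ _ (begin
  ∣ ∁ (S ∪ T) ∣ + ∣ ∁ (S ∩ T) ∣ + (∣ S ∣ + ∣ T ∣)          ≡⟨ cong (λ z → ∣ ∁ (S ∪ T) ∣ + ∣ ∁ (S ∩ T) ∣ + z) (∣∣-modular S T) ⟨
  ∣ ∁ (S ∪ T) ∣ + ∣ ∁ (S ∩ T) ∣ + (∣ S ∪ T ∣ + ∣ S ∩ T ∣)  ≡⟨ pair-up (S ∪ T) (S ∩ T) ⟩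
  n + n                                                    ≡⟨ pair-up S T ⟨
  ∣ ∁ S ∣ + ∣ ∁ T ∣ + (∣ S ∣ + ∣ T ∣)                      ∎)
  where
  open ≡-Reasoning
  interchange : ∀ a b c d → a + b + (c + d) ≡ a + c + (b + d)
  interchange = solve-∀
  pair-up : ∀ S T → ∣ ∁ S ∣ + ∣ ∁ T ∣ + (∣ S ∣ + ∣ T ∣) ≡ n + n
  pair-up S T = trans (interchange (∣ ∁ S ∣) (∣ ∁ T ∣) (∣ S ∣) (∣ T ∣)) (cong₂ _+_ (∣∁∣+∣∣ S) (∣∁∣+∣∣ T))

∣∣≡0⇒≡⊥ : ∀ {n} (S : Subset n) → ∣ S ∣ ≡ 0 → S ≡ ⊥
∣∣≡0⇒≡⊥ []            _    = refl
∣∣≡0⇒≡⊥ (outside ∷ S) ∣S∣≡0 = cong (outside ∷_) (∣∣≡0⇒≡⊥ S ∣S∣≡0)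

-- `2 ⊓ ∣ S ∣` is the rank function of the uniform matroid of rank 2. Its coefficient, one less than
-- the number of elements, makes singletons tie with the full set at `n + n`.
peaked : ∀ n → Subset (suc n) → ℕ
peaked n S = ∣ ∁ S ∣ + n * (2 ⊓ ∣ S ∣)

modular+rank : ∀ {n} k (S T : Subset n) {u v x y} → u + v ≤ x + y →
  (∣ ∁ (S ∪ T) ∣ + k * u) + (∣ ∁ (S ∩ T) ∣ + k * v) ≤ (∣ ∁ S ∣ + k * x) + (∣ ∁ T ∣ + k * y)
modular+rank k S T {u} {v} {x} {y} le = subst₂ _≤_
  (collect k ∣ ∁ (S ∪ T) ∣ ∣ ∁ (S ∩ T) ∣ u v) (collect k ∣ ∁ S ∣ ∣ ∁ T ∣ x y)
  (ℕ.+-mono-≤ (ℕ.≤-reflexive (∣∁∣-modular S T)) (ℕ.*-monoʳ-≤ k le))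
  where
  collect : ∀ k a b u v → a + b + k * (u + v) ≡ a + k * u + (b + k * v)
  collect = solve-∀

-- Two incomparable sets both exceed their intersection: both have rank at least 1 if it is empty,
-- and rank 2 otherwise. The union has rank at most 2.
peaked-submodular : ∀ n → Submodularℕ (peaked n)
peaked-submodular n S T with ⊑-or-∣∩∣< S T | ⊑-or-∣∩∣< T S
... | inj₁ S⊑T | _        = ℕ.≤-reflexive (⊑-modular (peaked n) S⊑T)
... | inj₂ _   | inj₁ T⊑S = ℕ.≤-reflexive (⊒-modular (peaked n) T⊑S)
... | inj₂ ltS | inj₂ ltT = modular+rank n S T
  (ℕ.≤-trans (ℕ.+-monoˡ-≤ _ (ℕ.m⊓n≤m 2 ∣ S ∪ T ∣)) (rank ltS (subst (_< ∣ T ∣) (cong ∣_∣ (∩-comm T S)) ltT)))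
  where
  rank : ∀ {s a b} → s < a → s < b → 2 + 2 ⊓ s ≤ 2 ⊓ a + 2 ⊓ b
  rank {zero}  (s≤s _)       (s≤s {n = b} _) = ℕ.+-mono-≤ {1} (s≤s z≤n) (s≤s z≤n)
  rank {suc s} (s≤s (s≤s _)) (s≤s (s≤s _)) = ℕ.+-monoʳ-≤ 2 (ℕ.m⊓n≤m 2 (suc s))

-- The two elements of `X` become parallel in the matroid. A set incomparable with `X` meets it in
-- at most one element, which leaves just enough slack.
peaked-lowered-submodular : ∀ n X → ∣ X ∣ ≡ 2 → Submodularℕ (override (peaked n) X (∣ ∁ X ∣ + n * 1))
peaked-lowered-submodular n X ∣X∣≡2 = override-submodular (peaked n) X _
  (ℕ.+-monoʳ-≤ ∣ ∁ X ∣ (ℕ.*-monoʳ-≤ n (subst (λ k → 1 ≤ 2 ⊓ k) (sym ∣X∣≡2) (s≤s z≤n))))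
  (peaked-submodular n) slack
  where
  rank : ∀ {s b} → s < 2 → s < b → 2 + 2 ⊓ s ≤ 1 + 2 ⊓ b
  rank {zero}        _              (s≤s _)       = s≤s (s≤s z≤n)
  rank {suc zero}    _              (s≤s (s≤s _)) = ℕ.≤-refl
  rank {suc (suc s)} (s≤s (s≤s ())) _

  slack : ∀ T → X ⊑ T ⊎ T ⊑ X ⊎ peaked n (X ∪ T) + peaked n (X ∩ T) ≤ ∣ ∁ X ∣ + n * 1 + peaked n T
  slack T with ⊑-or-∣∩∣< X T | ⊑-or-∣∩∣< T X
  ... | inj₁ X⊑T | _        = inj₁ X⊑T
  ... | inj₂ _   | inj₁ T⊑X = inj₂ (inj₁ T⊑X)
  ... | inj₂ ltX | inj₂ ltT = inj₂ (inj₂ (modular+rank n X T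
    (ℕ.≤-trans (ℕ.+-monoˡ-≤ _ (ℕ.m⊓n≤m 2 ∣ X ∪ T ∣))
      (rank (subst (∣ X ∩ T ∣ <_) ∣X∣≡2 ltX) (subst (_< ∣ T ∣) (cong ∣_∣ (∩-comm T X)) ltT)))))

peaked-min : ∀ n S → S ≢ ⊥ → n + n ≤ peaked n S
peaked-min n S S≢⊥ = go ∣ S ∣ refl
  where
  ∣∁S∣+_ : ∀ k → ∣ S ∣ ≡ k → ∣ ∁ S ∣ + k ≡ suc n
  (∣∁S∣+ k) refl = ∣∁∣+∣∣ S
  go : ∀ k → ∣ S ∣ ≡ k → n + n ≤ ∣ ∁ S ∣ + n * (2 ⊓ k)
  go zero          ∣S∣≡ = ⊥-elim (S≢⊥ (∣∣≡0⇒≡⊥ S ∣S∣≡))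
  go (suc zero)    ∣S∣≡ = ℕ.≤-reflexive (cong₂ _+_
    (ℕ.suc-injective (trans (sym ((∣∁S∣+ 1) ∣S∣≡)) (ℕ.+-comm ∣ ∁ S ∣ 1))) (sym (ℕ.*-identityʳ n)))
  go (suc (suc k)) ∣S∣≡ = ℕ.≤-trans (ℕ.≤-reflexive (n+n≡n*2 n)) (ℕ.m≤n+m (n * 2) ∣ ∁ S ∣)
    where
    n+n≡n*2 : ∀ n → n + n ≡ n * 2
    n+n≡n*2 = solve-∀

peaked-lowered-< : ∀ n X → ∣ X ∣ ≡ 2 → ∣ ∁ X ∣ + n * 1 < n + n
peaked-lowered-< n X ∣X∣≡2 = ℕ.≤-reflexive (cong₂ _+_
  (ℕ.suc-injective (trans (ℕ.+-comm 2 ∣ ∁ X ∣) (trans (cong (λ z → ∣ ∁ X ∣ + z) (sym ∣X∣≡2)) (∣∁∣+∣∣ X))))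
  (ℕ.*-identityʳ n))

-- A graph with many minimum cuts

-- A graph on a root and n + 1 further vertices: root n S is the weight between the
-- root and S, inner n S the cut of S among the non-root vertices. Going from n to
-- n + 1 doubles all weights and then splits the root into two twins, each with half
-- of its edges, joined by an edge of weight δ n; one twin becomes the head of
-- the subset. The root thus keeps degree δ.
δ : ℕ → ℕ
δ zero    = 1
δ (suc n) = 2 * δ n

root : ∀ n → Subset (suc n) → ℕ
root zero    (outside ∷ []) = 0
root zero    (inside  ∷ []) = 1
root (suc n) (outside ∷ S)  = root n S
root (suc n) (inside  ∷ S)  = δ n + root n S

∁-involutive : ∀ {n} (S : Subset n) → ∁ (∁ S) ≡ S
∁-involutive []      = refl
∁-involutive (b ∷ S) = cong₂ _∷_ (not-involutive b) (∁-involutive S)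

∁⊤≡⊥ : ∀ n → ∁ {n} ⊤ ≡ ⊥
∁⊤≡⊥ zero    = refl
∁⊤≡⊥ (suc n) = cong (outside ∷_) (∁⊤≡⊥ n)

∁⊥≡⊤ : ∀ n → ∁ {n} ⊥ ≡ ⊤
∁⊥≡⊤ n = trans (cong ∁ (sym (∁⊤≡⊥ n))) (∁-involutive ⊤)

root-⊥ : ∀ n → root n ⊥ ≡ 0
root-⊥ zero    = refl
root-⊥ (suc n) = root-⊥ n

root-∁ : ∀ n S → root n (∁ S) + root n S ≡ δ n
root-∁ zero    (outside ∷ []) = refl
root-∁ zero    (inside  ∷ []) = refl
root-∁ (suc n) (outside ∷ S)  = trans (ℕ.+-assoc (δ n) _ _)
  (cong (λ z → δ n + z) (trans (root-∁ n S) (sym (ℕ.+-identityʳ (δ n)))))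
root-∁ (suc n) (inside  ∷ S)  = trans (swap (root n (∁ S)) (δ n) (root n S))
  (cong (λ z → δ n + z) (trans (root-∁ n S) (sym (ℕ.+-identityʳ (δ n)))))
  where
  swap : ∀ a d b → a + (d + b) ≡ d + (a + b)
  swap = solve-∀

root-modular : ∀ n S T → root n (S ∪ T) + root n (S ∩ T) ≡ root n S + root n T
root-modular zero    (outside ∷ []) (outside ∷ []) = refl
root-modular zero    (outside ∷ []) (inside  ∷ []) = refl
root-modular zero    (inside  ∷ []) (outside ∷ []) = refl
root-modular zero    (inside  ∷ []) (inside  ∷ []) = refl
root-modular (suc n) (outside ∷ S)  (outside ∷ T)  = root-modular n S T
root-modular (suc n) (outside ∷ S)  (inside  ∷ T)  = trans (ℕ.+-assoc (δ n) _ _)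
  (trans (cong (λ z → δ n + z) (root-modular n S T)) (swap (δ n) (root n S) (root n T)))
  where
  swap : ∀ d a b → d + (a + b) ≡ a + (d + b)
  swap = solve-∀
root-modular (suc n) (inside  ∷ S)  (outside ∷ T)  = trans (ℕ.+-assoc (δ n) _ _)
  (trans (cong (λ z → δ n + z) (root-modular n S T)) (sym (ℕ.+-assoc (δ n) _ _)))
root-modular (suc n) (inside  ∷ S)  (inside  ∷ T)  = trans (collect (δ n) (root n (S ∪ T)) (root n (S ∩ T)))
  (trans (cong (λ z → δ n + δ n + z) (root-modular n S T)) (sym (collect (δ n) (root n S) (root n T))))
  where
  collect : ∀ d a b → d + a + (d + b) ≡ d + d + (a + b)
  collect = solve-∀

δ>0 : ∀ n → 0 < δ n
δ>0 zero    = s≤s z≤n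
δ>0 (suc n) = ℕ.≤-trans (δ>0 n) (ℕ.m≤m+n (δ n) _)

-- Every edge at the root has positive weight, so losing a vertex loses weight.
⊑-or-root< : ∀ n S T → S ⊑ T ⊎ root n (S ∩ T) < root n S
⊑-or-root< zero    (outside ∷ []) (_ ∷ [])       = inj₁ (refl , refl)
⊑-or-root< zero    (inside  ∷ []) (outside ∷ []) = inj₂ (s≤s z≤n)
⊑-or-root< zero    (inside  ∷ []) (inside  ∷ []) = inj₁ (refl , refl)
⊑-or-root< (suc n) (outside ∷ S)  (y ∷ T)        with ⊑-or-root< n S T
... | inj₁ S⊑T = inj₁ (⊑-outside y S⊑T)
... | inj₂ lt  = inj₂ lt
⊑-or-root< (suc n) (inside  ∷ S)  (inside  ∷ T)  with ⊑-or-root< n S T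
... | inj₁ S⊑T = inj₁ (⊑-inside S⊑T)
... | inj₂ lt  = inj₂ (ℕ.+-monoʳ-< (δ n) lt)
⊑-or-root< (suc n) (inside  ∷ S)  (outside ∷ T)  with ⊑-or-root< n S T
... | inj₁ (_ , ∩≡) = inj₂ (ℕ.+-mono-<-≤ (δ>0 n) (ℕ.≤-reflexive (cong (root n) ∩≡)))
... | inj₂ lt       = inj₂ (ℕ.+-mono-<-≤ (δ>0 n) (ℕ.<⇒≤ lt))

orient : ∀ {n} → Side → Subset n → Subset n
orient outside S = S
orient inside  S = ∁ S

-- Adds a head vertex with the same edges as the root. The factor 2 is for a twin of the root, and
-- the factor 1 for the root itself.
attach : ∀ n → ℕ → (Subset (suc n) → ℕ) → Subset (suc (suc n)) → ℕ
attach n k g (b ∷ S) = k * g S + root n (orient b S)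

inner : ∀ n → Subset (suc n) → ℕ
inner zero    S = 0
inner (suc n)   = attach n 2 (inner n)

cut : ∀ n → Subset (suc (suc n)) → ℕ
cut n = attach n 1 (inner n)

-- The slack is 2 since a cut and its complement are both lowered by 1.
Strict : ∀ {n} → (Subset n → ℕ) → Set
Strict f = ∀ S T → S ⊑ T ⊎ T ⊑ S ⊎ f (S ∪ T) + f (S ∩ T) + 2 ≤ f S + f T

Strict⇒Submodular : ∀ {n} {f : Subset n → ℕ} → Strict f → Submodularℕ f
Strict⇒Submodular {f = f} strict S T with strict S T
... | inj₁ S⊑T        = ℕ.≤-reflexive (⊑-modular f S⊑T)
... | inj₂ (inj₁ T⊑S) = ℕ.≤-reflexive (⊒-modular f T⊑S)
... | inj₂ (inj₂ le)  = ℕ.≤-trans (ℕ.m≤m+n _ 2) le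

-- Modularity of `root` with `S ∪ T` and `T` complemented by `root-∁`: the form needed when only the
-- second set contains the head.
root-∁-exchange : ∀ n S T → root n (∁ (S ∪ T)) + root n S ≡ root n (∁ T) + root n (S ∩ T)
root-∁-exchange n S T = ℕ.+-cancelʳ-≡ (root n T) _ _ (begin
  root n (∁ (S ∪ T)) + root n S + root n T                ≡⟨ ℕ.+-assoc (root n (∁ (S ∪ T))) _ _ ⟩
  root n (∁ (S ∪ T)) + (root n S + root n T)              ≡⟨ cong (λ z → root n (∁ (S ∪ T)) + z) (root-modular n S T) ⟨
  root n (∁ (S ∪ T)) + (root n (S ∪ T) + root n (S ∩ T))  ≡⟨ ℕ.+-assoc (root n (∁ (S ∪ T))) _ _ ⟨
  root n (∁ (S ∪ T)) + root n (S ∪ T) + root n (S ∩ T)    ≡⟨ cong (_+ root n (S ∩ T)) (trans (root-∁ n (S ∪ T)) (sym (root-∁ n T))) ⟩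
  root n (∁ T) + root n T + root n (S ∩ T)                ≡⟨ swap (root n (∁ T)) (root n T) (root n (S ∩ T)) ⟩
  root n (∁ T) + root n (S ∩ T) + root n T                ∎)
  where
  open ≡-Reasoning
  swap : ∀ a b c → a + b + c ≡ a + c + b
  swap = solve-∀

root-∁-modular : ∀ n S T → root n (∁ (S ∪ T)) + root n (∁ (S ∩ T)) ≡ root n (∁ S) + root n (∁ T)
root-∁-modular n S T = ℕ.+-cancelʳ-≡ (root n S) _ _ (begin
  root n (∁ (S ∪ T)) + root n (∁ (S ∩ T)) + root n S      ≡⟨ swap (root n (∁ (S ∪ T))) (root n (∁ (S ∩ T))) (root n S) ⟩
  root n (∁ (S ∪ T)) + root n S + root n (∁ (S ∩ T))      ≡⟨ cong (_+ root n (∁ (S ∩ T))) (root-∁-exchange n S T) ⟩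
  root n (∁ T) + root n (S ∩ T) + root n (∁ (S ∩ T))      ≡⟨ rotate (root n (∁ T)) (root n (S ∩ T)) (root n (∁ (S ∩ T))) ⟩
  root n (∁ T) + (root n (∁ (S ∩ T)) + root n (S ∩ T))    ≡⟨ cong (λ z → root n (∁ T) + z) (trans (root-∁ n (S ∩ T)) (sym (root-∁ n S))) ⟩
  root n (∁ T) + (root n (∁ S) + root n S)                ≡⟨ swap′ (root n (∁ T)) (root n (∁ S)) (root n S) ⟩
  root n (∁ S) + root n (∁ T) + root n S                  ∎)
  where
  open ≡-Reasoning
  swap : ∀ a b c → a + b + c ≡ a + c + b
  swap = solve-∀
  rotate : ∀ a b c → a + b + c ≡ a + (c + b)
  rotate = solve-∀
  swap′ : ∀ a b c → a + (b + c) ≡ b + a + c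
  swap′ = solve-∀

attach-combine : ∀ k a b c d a′ b′ c′ d′ e e′ → a + b + e ≤ c + d → a′ + b′ + e′ ≤ c′ + d′ →
  suc k * a + a′ + (suc k * b + b′) + (e + e′) ≤ suc k * c + c′ + (suc k * d + d′)
attach-combine k a b c d a′ b′ c′ d′ e e′ le le′ = begin
  suc k * a + a′ + (suc k * b + b′) + (e + e′)         ≤⟨ ℕ.m≤m+n _ (k * e) ⟩
  suc k * a + a′ + (suc k * b + b′) + (e + e′) + k * e ≡⟨ regroup k a b e a′ b′ e′ ⟩
  suc k * (a + b + e) + (a′ + b′ + e′)                 ≤⟨ ℕ.+-mono-≤ (ℕ.*-monoʳ-≤ (suc k) le) le′ ⟩
  suc k * (c + d) + (c′ + d′)                          ≡⟨ distribute k c d c′ d′ ⟩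
  suc k * c + c′ + (suc k * d + d′)                    ∎
  where
  open ℕ.≤-Reasoning
  regroup : ∀ k a b e a′ b′ e′ → suc k * a + a′ + (suc k * b + b′) + (e + e′) + k * e
    ≡ suc k * (a + b + e) + (a′ + b′ + e′)
  regroup = solve-∀
  distribute : ∀ k c d c′ d′ → suc k * (c + d) + (c′ + d′) ≡ suc k * c + c′ + (suc k * d + d′)
  distribute = solve-∀

-- If the head is in both sets or in neither, the slack comes from `g`. If it joins `T` only, the
-- edges from the head to the part of `S` outside `T` are cut by both sets, but by neither the union
-- nor the intersection. Their positive weight counts twice, giving slack 2.
attach-strict : ∀ n k {g} → Strict g → Strict (attach n (suc k) g)
attach-strict n k {g} strict = go
  where
  f = attach n (suc k) g

  mixed : ∀ S T → (outside ∷ S) ⊑ (inside ∷ T) ⊎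
    suc k * g (S ∪ T) + root n (∁ (S ∪ T)) + (suc k * g (S ∩ T) + root n (S ∩ T)) + 2
      ≤ suc k * g S + root n S + (suc k * g T + root n (∁ T))
  mixed S T with ⊑-or-root< n S T
  ... | inj₁ S⊑T = inj₁ (⊑-outside inside S⊑T)
  ... | inj₂ lt  = inj₂ (attach-combine k (g (S ∪ T)) (g (S ∩ T)) (g S) (g T)
    (root n (∁ (S ∪ T))) (root n (S ∩ T)) (root n S) (root n (∁ T)) 0 2
    (subst (_≤ g S + g T) (sym (ℕ.+-identityʳ _)) (Strict⇒Submodular {f = g} strict S T))
    (both lt (root-∁-exchange n S T)))
    where
    both : ∀ {u s v i} → i < s → u + s ≡ v + i → u + i + 2 ≤ s + v
    both {u} {s} {v} {i} i<s eq = ℕ.≤-trans (ℕ.≤-reflexive (shift u i))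
      (ℕ.+-mono-≤ i<s (ℕ.+-cancelʳ-≤ i (suc u) v
        (ℕ.≤-trans (ℕ.≤-reflexive (sym (ℕ.+-suc u i))) (ℕ.≤-trans (ℕ.+-monoʳ-≤ u i<s) (ℕ.≤-reflexive eq)))))
      where
      shift : ∀ u i → u + i + 2 ≡ suc i + suc u
      shift = solve-∀

  go : Strict f
  go (outside ∷ S) (outside ∷ T) with strict S T
  ... | inj₁ S⊑T        = inj₁ (⊑-outside outside S⊑T)
  ... | inj₂ (inj₁ T⊑S) = inj₂ (inj₁ (⊑-outside outside T⊑S))
  ... | inj₂ (inj₂ le)  = inj₂ (inj₂ (attach-combine k (g (S ∪ T)) (g (S ∩ T)) (g S) (g T)
    (root n (S ∪ T)) (root n (S ∩ T)) (root n S) (root n T) 2 0 le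
    (ℕ.≤-reflexive (trans (ℕ.+-identityʳ _) (root-modular n S T)))))
  go (inside ∷ S) (inside ∷ T) with strict S T
  ... | inj₁ S⊑T        = inj₁ (⊑-inside S⊑T)
  ... | inj₂ (inj₁ T⊑S) = inj₂ (inj₁ (⊑-inside T⊑S))
  ... | inj₂ (inj₂ le)  = inj₂ (inj₂ (attach-combine k (g (S ∪ T)) (g (S ∩ T)) (g S) (g T)
    (root n (∁ (S ∪ T))) (root n (∁ (S ∩ T))) (root n (∁ S)) (root n (∁ T)) 2 0 le
    (ℕ.≤-reflexive (trans (ℕ.+-identityʳ _) (root-∁-modular n S T)))))
  go (outside ∷ S) (inside ∷ T) with mixed S T
  ... | inj₁ S⊑T = inj₁ S⊑T
  ... | inj₂ le  = inj₂ (inj₂ le)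
  go (inside ∷ S) (outside ∷ T) with mixed T S
  ... | inj₁ T⊑S = inj₂ (inj₁ T⊑S)
  ... | inj₂ le  = inj₂ (inj₂ (subst₂ _≤_
    (cong (_+ 2) (∪-∩-comm f (outside ∷ T) (inside ∷ S)))
    (ℕ.+-comm (f (outside ∷ T)) (f (inside ∷ S))) le))

inner-strict : ∀ n → Strict (inner n)
inner-strict zero    S T = [ inj₁ , inj₂ ∘ inj₁ ]′ (singleton-⊑ S T)
inner-strict (suc n)     = attach-strict n 1 (inner-strict n)

cut-strict : ∀ n → Strict (cut n)
cut-strict n = attach-strict n 0 (inner-strict n)

-- Minimum cuts

orient-∁ : ∀ {n} b (S : Subset n) → orient (not b) (∁ S) ≡ orient b S
orient-∁ outside S = ∁-involutive S
orient-∁ inside  S = refl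

inner-∁ : ∀ n S → inner n (∁ S) ≡ inner n S
inner-∁ zero    S       = refl
inner-∁ (suc n) (b ∷ S) = cong₂ (λ x U → 2 * x + root n U) (inner-∁ n S) (orient-∁ b S)

-- A cut is represented by the side that avoids the head of the full vertex set.
rooted : ∀ {n} → Subset (suc n) → Subset n
rooted (b ∷ S) = orient b S

rooted-∁ : ∀ {n} (S : Subset (suc n)) → rooted (∁ S) ≡ rooted S
rooted-∁ (b ∷ S) = orient-∁ b S

rootedCut : ∀ n → Subset (suc n) → ℕ
rootedCut n X = inner n X + root n X

cut≡rootedCut : ∀ n S → cut n S ≡ rootedCut n (rooted S)
cut≡rootedCut n (outside ∷ S) = cong (_+ root n S) (ℕ.+-identityʳ (inner n S))
cut≡rootedCut n (inside  ∷ S) = cong (_+ root n (∁ S)) (trans (ℕ.+-identityʳ (inner n S)) (sym (inner-∁ n S)))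

inner-⊥ : ∀ n → inner n ⊥ ≡ 0
inner-⊥ zero    = refl
inner-⊥ (suc n) = cong₂ (λ x y → 2 * x + y) (inner-⊥ n) (root-⊥ n)

inner-⊤ : ∀ n → inner n ⊤ ≡ 0
inner-⊤ n = trans (sym (inner-∁ n ⊤)) (trans (cong (inner n) (∁⊤≡⊥ (suc n))) (inner-⊥ n))

rootedCut-⊥ : ∀ n → rootedCut n ⊥ ≡ 0
rootedCut-⊥ n = cong₂ _+_ (inner-⊥ n) (root-⊥ n)

-- The head is on the side of its twin, the root, so merging the two gives the smaller graph with
-- doubled weights.
rootedCut-outside : ∀ n X → rootedCut (suc n) (outside ∷ X) ≡ 2 * rootedCut n X
rootedCut-outside n X = eq (inner n X) (root n X)
  where
  eq : ∀ a b → 2 * a + b + b ≡ 2 * (a + b)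
  eq = solve-∀

-- With the twins separated, each other vertex has one of its two equal edges to them cut, `δ n` in
-- all. The edge joining the twins adds another `δ n`.
rootedCut-inside : ∀ n X → rootedCut (suc n) (inside ∷ X) ≡ 2 * inner n X + 2 * δ n
rootedCut-inside n X = trans (eq (inner n X) (root n (∁ X)) (δ n) (root n X))
  (cong (λ z → 2 * inner n X + (δ n + z)) (trans (root-∁ n X) (sym (ℕ.+-identityʳ (δ n)))))
  where
  eq : ∀ a b e f → 2 * a + b + (e + f) ≡ 2 * a + (e + (b + f))
  eq = solve-∀

rootedCut-min : ∀ n X → X ≢ ⊥ → δ n ≤ rootedCut n X
rootedCut-min zero    (outside ∷ []) X≢⊥ = ⊥-elim (X≢⊥ refl)
rootedCut-min zero    (inside  ∷ []) X≢⊥ = s≤s z≤n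
rootedCut-min (suc n) (outside ∷ X)  X≢⊥ = subst (2 * δ n ≤_) (sym (rootedCut-outside n X))
  (ℕ.*-monoʳ-≤ 2 (rootedCut-min n X (X≢⊥ ∘ cong (outside ∷_))))
rootedCut-min (suc n) (inside  ∷ X)  X≢⊥ = subst (2 * δ n ≤_) (sym (rootedCut-inside n X))
  (ℕ.m≤n+m (2 * δ n) (2 * inner n X))

-- Each split keeps the earlier minimizers, with both twins on one side, and adds two: `inside ∷ ⊥`
-- isolates the head and `inside ∷ ⊤` isolates the root.
unqueried-minimizer : ∀ n (Q : List (Subset (suc n))) → length Q < suc (2 * n) →
  ∃[ X ] rootedCut n X ≡ δ n × X ∉ Q
unqueried-minimizer zero    []      lt = ⊤ , refl , λ ()
unqueried-minimizer zero    (_ ∷ _) (s≤s ())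
unqueried-minimizer (suc n) Q lt with section-< Q {2} (subst (length Q <_) (cong suc (ℕ.*-suc 2 n)) lt)
... | inj₂ out< =
  let X , dX≡δ , X∉ = unqueried-minimizer n (section outside Q) out<
  in outside ∷ X , trans (rootedCut-outside n X) (cong (2 *_) dX≡δ) , X∉ ∘ ∈-section outside
... | inj₁ in<2 with ⊥ ∈? section inside Q
...   | no ⊥∉ = inside ∷ ⊥ , trans (rootedCut-inside n ⊥) (cong (λ x → 2 * x + 2 * δ n) (inner-⊥ n)) ,
  ⊥∉ ∘ ∈-section inside
...   | yes ⊥∈ = inside ∷ ⊤ , trans (rootedCut-inside n ⊤) (cong (λ x → 2 * x + 2 * δ n) (inner-⊤ n)) ,
  λ ⊤∈ → ⊥≢⊤ (length<2⇒≡ in<2 ⊥∈ (∈-section inside ⊤∈))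
  where
  ⊥≢⊤ : ⊥ {suc n} ≢ ⊤
  ⊥≢⊤ ()

-- Overriding through `rooted` lowers a cut and its complement together, which preserves symmetry.
lowered : ∀ n → Subset (suc n) → Subset (suc (suc n)) → ℕ
lowered n X S = override (rootedCut n) X (pred (rootedCut n X)) (rooted S)

lowered-≤ : ∀ n X S → lowered n X S ≤ cut n S
lowered-≤ n X S = subst (lowered n X S ≤_) (sym (cut≡rootedCut n S))
  (override-≤ (rootedCut n) X _ ℕ.pred[n]≤n (rooted S))

cut≤suc-lowered : ∀ n X S → cut n S ≤ suc (lowered n X S)
cut≤suc-lowered n X S = subst (_≤ suc (lowered n X S)) (sym (cut≡rootedCut n S)) (go (rooted S))
  where
  go : ∀ Y → rootedCut n Y ≤ suc (override (rootedCut n) X (pred (rootedCut n X)) Y)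
  go Y with Y ≟ˢ X
  ... | yes refl = ℕ.m≤n+m∸n (rootedCut n X) 1
  ... | no _     = ℕ.n≤1+n (rootedCut n Y)

lowered-submodular : ∀ n X → Submodularℕ (lowered n X)
lowered-submodular n X S T with cut-strict n S T
... | inj₁ S⊑T        = ℕ.≤-reflexive (⊑-modular (lowered n X) S⊑T)
... | inj₂ (inj₁ T⊑S) = ℕ.≤-reflexive (⊒-modular (lowered n X) T⊑S)
... | inj₂ (inj₂ le)  = ℕ.+-cancelʳ-≤ 2 _ _ (begin
  lowered n X (S ∪ T) + lowered n X (S ∩ T) + 2  ≤⟨ ℕ.+-monoˡ-≤ 2 (ℕ.+-mono-≤ (lowered-≤ n X (S ∪ T)) (lowered-≤ n X (S ∩ T))) ⟩
  cut n (S ∪ T) + cut n (S ∩ T) + 2              ≤⟨ le ⟩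
  cut n S + cut n T                              ≤⟨ ℕ.+-mono-≤ (cut≤suc-lowered n X S) (cut≤suc-lowered n X T) ⟩
  suc (lowered n X S) + suc (lowered n X T)      ≡⟨ shift (lowered n X S) (lowered n X T) ⟩
  lowered n X S + lowered n X T + 2              ∎)
  where
  open ℕ.≤-Reasoning
  shift : ∀ a b → suc a + suc b ≡ a + b + 2
  shift = solve-∀

-- The three bounds

ι-submodular : ∀ {n} (f : Subset n → ℕ) → Submodularℕ f → Submodular (ι ∘ f)
ι-submodular f sub S T = ι-mono-+ (f (S ∪ T)) (f (S ∩ T)) (f S) (f T) (sub S T)

SFM-bound : ∀ n q → SolvableWithin (SFM n) q → 2 * n ≤ q
SFM-bound n = adversary-bound (SFM n) (hard 0 n) 1 (2 * n)
  (ι-submodular (hard 0 n) (hard-submodular 0 n)) (λ S _ → hard>0 0 n S) fool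
  where
  fool : ∀ Q → length Q < 2 * n → Fooled (SFM n) (hard 0 n) 1 Q
  fool Q lt =
    let g , agree , sub , _ , X , gX≡0 = hard-fooled 0 n Q lt
    in g , agree , ι-submodular g sub , X , _ , ℕ.≤-reflexive (cong suc gX≡0)

NontrivialSymmetricSFM-bound : ∀ n q →
  SolvableWithin (NontrivialSymmetricSFM (suc (suc n))) q → suc (2 * n) ≤ q
NontrivialSymmetricSFM-bound n = adversary-bound P (cut n) (δ n) (suc (2 * n))
  (rooted-instance (cut n) (rootedCut n) (cut≡rootedCut n) (Strict⇒Submodular {f = cut n} (cut-strict n)))
  (λ S S∈ → subst (δ n ≤_) (sym (cut≡rootedCut n S)) (rootedCut-min n (rooted S) (rooted≢⊥ S S∈)))
  fool
  where
  P = NontrivialSymmetricSFM (suc (suc n))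

  rooted-instance : ∀ f f̂ → (∀ S → f S ≡ f̂ (rooted S)) → Submodularℕ f → Instance P (ι ∘ f)
  rooted-instance f f̂ f≡ sub = ι-submodular f sub , λ S →
    ι-mono-≤ (f S) (f (∁ S)) (ℕ.≤-reflexive (f≡f∁ S)) ,
    ι-mono-≤ (f (∁ S)) (f S) (ℕ.≤-reflexive (sym (f≡f∁ S)))
    where
    f≡f∁ : ∀ S → f S ≡ f (∁ S)
    f≡f∁ S = trans (f≡ S) (trans (cong f̂ (sym (rooted-∁ S))) (sym (f≡ (∁ S))))

  rooted≢⊥ : ∀ S → Nontrivial S → rooted S ≢ ⊥
  rooted≢⊥ (outside ∷ S) (≢⊥ , _) S≡⊥  = ≢⊥ (cong (outside ∷_) S≡⊥)
  rooted≢⊥ (inside  ∷ S) (_ , ≢⊤) ∁S≡⊥ = ≢⊤ (cong (inside ∷_)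
    (trans (sym (∁-involutive S)) (trans (cong ∁ ∁S≡⊥) (∁⊥≡⊤ (suc n)))))

  fool : ∀ Q → length Q < suc (2 * n) → Fooled P (cut n) (δ n) Q
  -- A query to either side of a cut counts as a query to that cut.
  fool Q lt with unqueried-minimizer n (map rooted Q) (subst (_< suc (2 * n)) (sym (length-map rooted Q)) lt)
  ... | X , X≡δ , X∉ = lowered n X , agree
    , rooted-instance (lowered n X) (override (rootedCut n) X (pred (rootedCut n X)))
        (λ _ → refl) (lowered-submodular n X)
    , outside ∷ X , (X≢⊥ , λ ())
    , subst (_< δ n) (sym (trans (override-same (rootedCut n) X _) (cong pred X≡δ))) (pred< (δ>0 n))
    where
    agree : Agree Q (lowered n X) (cut n)
    agree {S} S∈ = trans (override-agree (rootedCut n) X _ X∉ (∈-map⁺ rooted S∈)) (sym (cut≡rootedCut n S))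
    X≢⊥ : outside ∷ X ≢ ⊥
    X≢⊥ refl = ℕ.<⇒≢ (δ>0 n) (trans (sym (rootedCut-⊥ n)) X≡δ)
    pred< : ∀ {k} → 0 < k → pred k < k
    pred< (s≤s _) = ℕ.≤-refl

NontrivialSFM-bound : ∀ n q → SolvableWithin (NontrivialSFM (suc (suc n))) q → suc (suc n) C 2 ≤ q
-- On two elements the only 2-element set is `⊤`, which is not feasible. The bound is then a single
-- query, and constant functions suffice.
NontrivialSFM-bound zero = adversary-bound P (λ _ → 1) 1 (2 C 2)
  (ι-submodular {2} (λ _ → 1) (λ _ _ → ℕ.≤-refl)) (λ _ _ → ℕ.≤-refl) fool
  where
  P = NontrivialSFM 2
  fool : ∀ Q → length Q < 2 C 2 → Fooled P (λ _ → 1) 1 Q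
  fool []      _ = (λ _ → 0) , (λ ()) , ι-submodular {2} (λ _ → 0) (λ _ _ → ℕ.≤-refl)
    , inside ∷ outside ∷ [] , ((λ ()) , (λ ())) , s≤s z≤n
  fool (_ ∷ _) (s≤s ())
NontrivialSFM-bound (suc n) = adversary-bound P (peaked k) (k + k) (suc k C 2)
  (ι-submodular (peaked k) (peaked-submodular k)) (λ S S∈ → peaked-min k S (proj₁ S∈)) fool
  where
  k = suc (suc n)
  P = NontrivialSFM (suc k)
  fool : ∀ Q → length Q < suc k C 2 → Fooled P (peaked k) (k + k) Q
  fool Q lt with unqueried-of-size (suc k) 2 Q lt
  ... | X , ∣X∣≡2 , X∉ = g
    , override-agree (peaked k) X _ X∉
    , ι-submodular g (peaked-lowered-submodular k X ∣X∣≡2)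
    , X , (X≢⊥ , X≢⊤)
    , subst (_< k + k) (sym (override-same (peaked k) X _)) (peaked-lowered-< k X ∣X∣≡2)
    where
    g = override (peaked k) X (∣ ∁ X ∣ + k * 1)
    X≢⊥ : X ≢ ⊥
    X≢⊥ refl with trans (sym (∣⊥∣≡0 (suc k))) ∣X∣≡2
    ... | ()
    X≢⊤ : X ≢ ⊤
    X≢⊤ refl with trans (sym (∣⊤∣≡n (suc k))) ∣X∣≡2
    ... | ()

-- On N = n + 2 elements the bound obtained is 2N - 3, which exceeds 3N/2 - 2 by n/2.
3n/2-2≤ : ∀ n q → suc (2 * n) ≤ q → + (3 * suc (suc n)) / 2 - + 2 / 1 ℚ.≤ + q / 1
3n/2-2≤ n q le = begin
  + m / 2 - + 2 / 1                     ≤⟨ ℚ.+-monoˡ-≤ (ℚ.- (+ 2 / 1)) (/-mono-≤ m (q + 2) 1 0 m≤) ⟩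
  + (q + 2) / 1 - + 2 / 1               ≡⟨ cong (_- + 2 / 1) (/1-homo-+ q 2) ⟩
  (+ q / 1 ℚ.+ + 2 / 1) - + 2 / 1       ≡⟨ ℚ.+-assoc (+ q / 1) (+ 2 / 1) (ℚ.- (+ 2 / 1)) ⟩
  + q / 1 ℚ.+ (+ 2 / 1 - + 2 / 1)       ≡⟨ cong (+ q / 1 ℚ.+_) (ℚ.+-inverseʳ (+ 2 / 1)) ⟩
  + q / 1 ℚ.+ 0ℚ                        ≡⟨ ℚ.+-identityʳ (+ q / 1) ⟩
  + q / 1                               ∎
  where
  open ℚ.≤-Reasoning
  m = 3 * suc (suc n)
  split : ∀ n → 3 * suc (suc n) * 1 + n ≡ (suc (2 * n) + 2) * 2
  split = solve-∀
  m≤ : m * 1 ≤ (q + 2) * 2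
  m≤ = ℕ.≤-trans (ℕ.m≤m+n (m * 1) n)
    (ℕ.≤-trans (ℕ.≤-reflexive (split n)) (ℕ.*-monoˡ-≤ 2 (ℕ.+-monoˡ-≤ 2 le)))

theorem1p2 : (∀ (n : ℕ) → n ≥ 1 → QueryComplexity≥ (SFM n) (+ (2 * n) / 1))
    × (∀ (n : ℕ) → n ≥ 2 → QueryComplexity≥ (NontrivialSymmetricSFM n) (+ (3 * n) / 2 - + 2 / 1))
    × (∀ (n : ℕ) → n ≥ 2 → QueryComplexity≥ (NontrivialSFM n) (+ (n C 2) / 1))
theorem1p2 =
    (λ n _ q solvable → /1-mono-≤ (2 * n) q (SFM-bound n q solvable))
  , (λ { (suc (suc n)) (s≤s (s≤s _)) q solvable → 3n/2-2≤ n q (NontrivialSymmetricSFM-bound n q solvable) })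
  , (λ { (suc (suc n)) (s≤s (s≤s _)) q solvable →
         /1-mono-≤ (suc (suc n) C 2) q (NontrivialSFM-bound n q solvable) })
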